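{- Let $\varphi$ be a specification. If $\varphi$ is realizable, then incremental synthesis yields strategies for all components, using the components and synthesis order induced by the extended semantic component selection algorithm.
   Context: Setting: finite variable set $V=\mathit{inp}\cup\mathit{out}$; $\varphi$ is an LTL formula over $V$ that is a conjunction of conjunction-free formulas in negation normal form (assumptions treated as conjuncts). Components have pairwise disjoint output sets covering $\mathit{out}$. Strategies are finite Moore machines; $\mathit{comp}(s,\gamma)$ is the produced trace; $s$ is dominant for $\varphi$ if for every alternative strategy $t$ for the same component and every $\gamma$, $\mathit{comp}(t,\gamma)\models\varphi$ implies $\mathit{comp}(s,\gamma)\models\varphi$; $\varphi$ is realizable if some strategy of the whole system satisfies $\varphi$ on every input sequence; $\|$ denotes parallel composition. Implementation order: ranks $\mathit{rank}_{\mathit{impl}}$ on output variables; $\mathit{rank}_{\mathit{impl}}(v)<\mathit{rank}_{\mathit{impl}}(u)$ means the controller of $u$ sees the current value of $v$. Semantic dependencies ($\gamma\cup\pi$ pointwise union; $\eta\cap\mathit{inp},\eta\cap\mathit{out}$ pointwise intersections). Minimal satisfying changeset: for $\gamma\in(2^{\mathit{inp}})^\omega$, $\pi\in(2^{\mathit{out}})^\omega$ with $\gamma\cup\pi\not\models\varphi$, $u\in\mathit{out}$, $i$, $P\subseteq\mathit{out}\setminus\{u\}$, $F\subseteq\mathit{out}$, $\Pi^{P,F}$ is the set of $\pi'$ equal to $\pi$ before $i$, differing from $\pi_i$ at $i$ exactly in $P$, each $v\in F$ differing from $\pi$ at some position $>i$, variables outside $F$ agreeing with $\pi$ after $i$;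 $(P,F)$ is minimal satisfying w.r.t. $\varphi,\gamma,\pi,i$ if some $\pi'\in\Pi^{P,F}$ has $\gamma\cup\pi'\models\varphi$ and for all $P'\subset P,F'\subset F$ no $\pi''\in\Pi^{P',F'}$ does. For $u\in\mathit{out}$, $\eta,\eta'\in(2^V)^{i+1}$ equal before $i$ with $\eta'_i$ differing from $\eta_i$ exactly in $u$, and $\gamma,\pi$ with prefixes $\eta\cap\mathit{inp},\eta\cap\mathit{out}$ and $\gamma\cup\pi\models\varphi$: $u$ depends on $(P,F)$ if some $\pi'$ with prefix $\eta'\cap\mathit{out}$ and $\pi'_j=\pi_j$ for $j>i$ has $\gamma\cup\pi'\not\models\varphi$ and $(P,F)$ is minimal satisfying w.r.t. $\varphi,\gamma,\pi',i$; current (future) dependency on $v$ if $v\in P$ ($v\in F$) for some instance; $u$ depends on the input if for some instance no $\pi''$ with prefix $\eta'\cap\mathit{out}$ has $\gamma\cup\pi''\models\varphi$ but some $\gamma'$ with prefix $\eta\cap\mathit{inp}$ and $\pi''$ with prefix $\eta'\cap\mathit{out}$ have $\gamma'\cup\pi''\models\varphi$. Semantic component selection: on the dependency graph (vertices $V$, edges for present, future and input dependencies), remove input vertices; drop present edges that are also future edges; remove each remaining present edge $(u,v)$ by adding $\mathit{rank}_{\mathit{impl}}(v)<\mathit{rank}_{\mathit{impl}}(u)$ when this keeps the implementation order consistent; the SCCs $C_1,\dots,C_k$ give components $p_j$ with $\mathit{out}(p_j)=C_j$. Synthesis order: layer 0 = SCCs with no edges to other SCCs, layer $i$ = remaining SCCs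 whose edges to other SCCs all lead into earlier layers; lower layers get strictly smaller $\mathit{rank}_{\mathit{syn}}$; same-layer components get equal rank if $\varphi$ is safety or only one of them affects the liveness part of $\varphi$, otherwise are ordered arbitrarily. Incremental synthesis: process ranks in increasing order; for each component $p$ find a strategy $s$ such that $t\|s$ is dominant for $\varphi$, where $t$ composes the strategies found for all components of smaller rank. Extended semantic component selection: run incremental synthesis; whenever $p$ is the smallest component (in synthesis order) for which no strategy $s$ with $t\|s$ dominant exists, merge $p$ with a direct successor $p'$ in the synthesis order into one component and retry; if still no such strategy exists, merge another direct successor of $p$, or if none exists a direct successor of $p'$; repeat until such a strategy exists or only a single component is left.
   Formalization: The extended selection algorithm as worded can get stuck when the failing component has no direct successor but other components remain; here it is then merged with a component of equal synthesis rank or, lacking one, with a component of which it is a direct successor. -}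

module Defs where

open import Data.Bool using (Bool; true; false; if_then_else_; not; _∧_)
open import Data.Fin using (Fin; combine; remQuot) renaming (zero to 0F)
open import Data.Fin.Subset
  using (Subset; Nonempty; ⊤; ⊥; ∁; _∩_; _∪_; ⋃; _∈_; _∉_; _⊆_; _⊂_)
open import Data.List using (List; []; _∷_; map; mapMaybe; filter)
open import Data.List.Membership.Propositional
  using (_∷=_; _─_) renaming (_∈_ to _∈ˡ_; _∉_ to _∉ˡ_)
open import Data.List.Relation.Unary.All using (All)
open import Data.List.Relation.Unary.Any using (Any)
open import Data.List.Relation.Unary.Unique.Propositional using (Unique)
open import Data.Maybe using (Maybe; just; nothing; Is-just)
import Data.Maybe as Maybe
open import Data.Nat
  using (ℕ; zero; suc; _*_; _⊓_; _≤_; _<_; _<ᵇ_; _≡ᵇ_; _<?_)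
open import Data.Product using (Σ; Σ-syntax; ∃; ∃-syntax; _×_; _,_; proj₁; proj₂)
open import Data.Sum using (_⊎_; inj₁; inj₂)
import Data.Unit as Unit
import Data.Empty as Empty
open import Data.Vec using (lookup; tabulate; _[_]%=_)
open import Function using (flip; _⇔_)
open import Induction.WellFounded using (Acc)
open import Relation.Binary.Construct.Closure.ReflexiveTransitive using (Star)
open import Relation.Binary.PropositionalEquality using (_≡_; _≢_)
open import Relation.Nullary using (¬_)

-- There are m input variables and n output variables.

Var : ℕ → ℕ → Set
Var m n = Fin m ⊎ Fin n

pattern input x  = inj₁ x
pattern output u = inj₂ u

Letter : ℕ → ℕ → Set
Letter m n = Subset m × Subset n

Word : ℕ → ℕ → Set
Word m n = ℕ → Letter m n

_∪ʷ_ : ∀ {m n} → (ℕ → Subset m) → (ℕ → Subset n) → Word m n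
(γ ∪ʷ π) k = γ k , π k

AgreeBelow : {A : Set} → ℕ → (ℕ → A) → (ℕ → A) → Set
AgreeBelow k σ τ = ∀ j → j < k → σ j ≡ τ j

-- Conjunction-free LTL in negation normal form.  As usual,
-- F ψ = tt U ψ and G ψ = ff R ψ.

infixr 6 _∨ᶠ_
infixr 7 _U_ _R_

data Formula (m n : ℕ) : Set where
  tt ff   : Formula m n
  pos neg : Var m n → Formula m n
  _∨ᶠ_    : Formula m n → Formula m n → Formula m n
  X       : Formula m n → Formula m n
  _U_ _R_ : Formula m n → Formula m n → Formula m n

-- The conjunction of the listed formulas.

Specification : ℕ → ℕ → Set
Specification m n = List (Formula m n)

value : ∀ {m n} → Letter m n → Var m n → Bool
value (i , o) (input x)  = lookup i x
value (i , o) (output u) = lookup o u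

infix 4 _,_⊨ᶠ_ _⊨_

_,_⊨ᶠ_ : ∀ {m n} → Word m n → ℕ → Formula m n → Set
σ , k ⊨ᶠ tt       = Unit.⊤
σ , k ⊨ᶠ ff       = Empty.⊥
σ , k ⊨ᶠ pos x    = value (σ k) x ≡ true
σ , k ⊨ᶠ neg x    = value (σ k) x ≡ false
σ , k ⊨ᶠ (a ∨ᶠ b) = σ , k ⊨ᶠ a ⊎ σ , k ⊨ᶠ b
σ , k ⊨ᶠ X a      = σ , suc k ⊨ᶠ a
σ , k ⊨ᶠ (a U b)  =
  ∃[ j ] k ≤ j × σ , j ⊨ᶠ b × (∀ l → k ≤ l → l < j → σ , l ⊨ᶠ a)
σ , k ⊨ᶠ (a R b)  =
  ∀ j → k ≤ j → σ , j ⊨ᶠ b ⊎ (∃[ l ] k ≤ l × l < j × σ , l ⊨ᶠ a)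

_⊨_ : ∀ {m n} → Word m n → Specification m n → Set
σ ⊨ φ = All (λ c → σ , 0 ⊨ᶠ c) φ

data Occurs {m n} (x : Var m n) : Formula m n → Set where
  pos : Occurs x (pos x)
  neg : Occurs x (neg x)
  ∨ˡ  : ∀ {a b} → Occurs x a → Occurs x (a ∨ᶠ b)
  ∨ʳ  : ∀ {a b} → Occurs x b → Occurs x (a ∨ᶠ b)
  X   : ∀ {a} → Occurs x a → Occurs x (X a)
  Uˡ  : ∀ {a b} → Occurs x a → Occurs x (a U b)
  Uʳ  : ∀ {a b} → Occurs x b → Occurs x (a U b)
  Rˡ  : ∀ {a b} → Occurs x a → Occurs x (a R b)
  Rʳ  : ∀ {a b} → Occurs x b → Occurs x (a R b)

-- Every word outside a safety language has a bad prefix.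

IsSafety : ∀ {m n} → (Word m n → Set) → Set
IsSafety L = ∀ σ → ¬ L σ → ∃[ k ] ∀ τ → AgreeBelow k σ τ → ¬ L τ

-- The liveness part of φ consists of the conjuncts that are not safety
-- properties; a set of outputs affects it if one of them occurs there.

AffectsLiveness : ∀ {m n} → Specification m n → Subset n → Set
AffectsLiveness φ C =
  ∃[ c ] c ∈ˡ φ × ¬ IsSafety (λ σ → σ , 0 ⊨ᶠ c) ×
         ∃[ u ] u ∈ C × Occurs (output u) c

-- rank v < rank u: the controller of u sees the current value of v.

ImplementationOrder : ℕ → Set
ImplementationOrder n = Fin n → ℕ

-- A Moore machine for the component with output set C; its inputs are all
-- variables outside C.  `out q u o` is the value of u ∈ C in state q, where
-- o holds the current values that the controller of u sees, and
-- `next q i e` is the successor of q on input letter i, e.  The masking of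
-- o and e to the variables that may be read is done by `settle` and by
-- `states`.

record Strategy (m : ℕ) {n : ℕ} (C : Subset n) : Set where
  field
    size : ℕ
    init : Fin size
    out  : Fin size → Fin n → Subset n → Bool
    next : Fin size → Subset m → Subset n → Fin size

open Strategy

module _ {n} (rank : ImplementationOrder n) where

  -- The current value of every output variable, given the output functions
  -- of the variables in C and the environment's values e of the others.
  -- The value of u depends only on variables of lower rank, so fuel r
  -- suffices for variables of rank at most r.

  settle : Subset n → (Fin n → Subset n → Bool) → Subset n → Subset n
  settle C f e = tabulate λ u → current (rank u) u
    where
    current : ℕ → Fin n → Bool
    current r u = if lookup C u then f u (seen r) else lookup e u
      where
      seen : ℕ → Subset n
      seen zero    = ⊥
      seen (suc r) = tabulate λ v → (rank v <ᵇ rank u) ∧ current r v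

  module _ {m} {C : Subset n} (s : Strategy m C) (γ : Word m n) where

    states : ℕ → Fin (size s)
    states zero    = init s
    states (suc k) = next s (states k) (proj₁ (γ k)) (proj₂ (γ k) ∩ ∁ C)

    -- The C-part of γ is ignored.

    comp : Word m n
    comp k = proj₁ (γ k) , settle C (out s (states k)) (proj₂ (γ k))

  infixr 6 _∥_

  -- To be used for disjoint C and D.  Each machine reads the outputs of the
  -- other one.

  _∥_ : ∀ {m} {C D : Subset n} →
        Strategy m C → Strategy m D → Strategy m (C ∪ D)
  _∥_ {m} {C} {D} t s = record
    { size = size t * size s
    ; init = combine (init t) (init s)
    ; out  = both
    ; next = λ q i e →
        let o = settle (C ∪ D) (both q) e in
        combine (next t (left q)  i (o ∩ ∁ C))
                (next s (right q) i (o ∩ ∁ D))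
    }
    where
    left : Fin (size t * size s) → Fin (size t)
    left q = proj₁ (remQuot (size s) q)

    right : Fin (size t * size s) → Fin (size s)
    right q = proj₂ (remQuot {size t} (size s) q)

    both : Fin (size t * size s) → Fin n → Subset n → Bool
    both q u o =
      if lookup C u then out t (left q) u o else out s (right q) u o

  Dominant : ∀ {m} {C : Subset n} → Specification m n → Strategy m C → Set
  Dominant {m} {C} φ s =
    (t : Strategy m C) (γ : Word m n) → comp t γ ⊨ φ → comp s γ ⊨ φ

idle : ∀ {m n} → Strategy m {n} ⊥
idle = record
  { size = 1 ; init = 0F ; out = λ _ _ _ → false ; next = λ q _ _ → q }

-- A constant rank makes no current value visible, so the system strategy is
-- a plain Moore machine over the inputs.

Realizable : ∀ {m n} → Specification m n → Set
Realizable {m} {n} φ =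
  Σ[ s ∈ Strategy m ⊤ ]
    ((γ : ℕ → Subset m) → comp (λ _ → 0) s (γ ∪ʷ λ _ → ⊥) ⊨ φ)

module _ {m n} (φ : Specification m n) where

  -- π′ ∈ Π^{P,F}, formed from π at position i.

  record Change (π : ℕ → Subset n) (i : ℕ) (P F : Subset n)
                (π′ : ℕ → Subset n) : Set where
    field
      before  : AgreeBelow i π π′
      current : ∀ v → v ∈ P ⇔ (lookup (π′ i) v ≢ lookup (π i) v)
      after   : ∀ v → v ∈ F →
                ∃[ j ] i < j × lookup (π′ j) v ≢ lookup (π j) v
      rest    : ∀ v → v ∉ F → ∀ j → i < j → lookup (π′ j) v ≡ lookup (π j) v

  record MinimalSatisfying (γ : ℕ → Subset m) (π : ℕ → Subset n) (u : Fin n)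
                           (i : ℕ) (P F : Subset n) : Set where
    field
      violated   : ¬ (γ ∪ʷ π ⊨ φ)
      u∉P        : u ∉ P
      satisfying : ∃[ π′ ] Change π i P F π′ × γ ∪ʷ π′ ⊨ φ
      -- No pair strictly below (P , F) in the componentwise order works.
      minimal    : ∀ {P′ F′} → P′ ⊆ P → F′ ⊆ F → P′ ⊂ P ⊎ F′ ⊂ F →
                   ∀ π″ → Change π i P′ F′ π″ → ¬ (γ ∪ʷ π″ ⊨ φ)

  -- If η is the prefix of length i+1 of γ ∪ʷ π, then η′ is that of
  -- γ ∪ʷ flipAt i u π, and flipAt i u π is the only sequence that has the
  -- prefix η′ ∩ out and equals π after i.

  flipAt : ℕ → Fin n → (ℕ → Subset n) → (ℕ → Subset n)
  flipAt i u π j = if j ≡ᵇ i then π j [ u ]%= not else π j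

  DependsOn : Fin n → Subset n → Subset n → Set
  DependsOn u P F =
    ∃[ i ] ∃[ γ ] ∃[ π ]
      γ ∪ʷ π ⊨ φ × MinimalSatisfying γ (flipAt i u π) u i P F

  CurrentDependency FutureDependency : Fin n → Fin n → Set
  CurrentDependency u v = ∃[ P ] ∃[ F ] DependsOn u P F × v ∈ P
  FutureDependency  u v = ∃[ P ] ∃[ F ] DependsOn u P F × v ∈ F

  DependsOnInput : Fin n → Set
  DependsOnInput u =
    ∃[ i ] ∃[ γ ] ∃[ π ] γ ∪ʷ π ⊨ φ ×
      ¬ (∃[ π″ ] AgreeBelow (suc i) (flipAt i u π) π″ × γ ∪ʷ π″ ⊨ φ) ×
      (∃[ γ′ ] ∃[ π″ ] AgreeBelow (suc i) γ γ′ ×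
        AgreeBelow (suc i) (flipAt i u π) π″ × γ′ ∪ʷ π″ ⊨ φ)

  data EdgeKind : Set where
    present future fromInput : EdgeKind

  data Edge : EdgeKind → Var m n → Var m n → Set where
    present   : ∀ {u v} → CurrentDependency u v →
                Edge present (output u) (output v)
    future    : ∀ {u v} → FutureDependency u v →
                Edge future (output u) (output v)
    fromInput : ∀ {u x} → DependsOnInput u →
                Edge fromInput (output u) (input x)

  -- Once the input vertices are removed, only edges between outputs remain.

  FutureEdge PresentEdge : Fin n × Fin n → Set
  FutureEdge (u , v)  = Edge future (output u) (output v)
  PresentEdge (u , v) =
    Edge present (output u) (output v) × ¬ FutureEdge (u , v)

  Respects : ImplementationOrder n → List (Fin n × Fin n) → Set
  Respects rank = All (λ (u , v) → rank v < rank u)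

  Consistent : List (Fin n × Fin n) → Set
  Consistent es = ∃[ rank ] Respects rank es

  -- `Remove es r r′`: the edges es are treated one after the other; r are
  -- the edges removed before, r′ those removed in the end.  Removing (u , v)
  -- adds the constraint rank v < rank u.

  data Remove : (es r r′ : List (Fin n × Fin n)) → Set where
    done : ∀ {r} → Remove [] r r
    drop : ∀ {e es r r′} → Consistent (e ∷ r) →
           Remove es (e ∷ r) r′ → Remove (e ∷ es) r r′
    keep : ∀ {e es r r′} → ¬ Consistent (e ∷ r) →
           Remove es r r′ → Remove (e ∷ es) r r′

module _ {n} (_↝_ : Fin n → Fin n → Set) where

  IsSCC : Subset n → Set
  IsSCC C = Nonempty C ×
    (∀ u v → u ∈ C → v ∈ C ⇔ (Star _↝_ u v × Star _↝_ v u))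

  record SCCs (Cs : List (Subset n)) : Set where
    field
      unique : Unique Cs
      sccs   : All IsSCC Cs
      cover  : ∀ v → Any (v ∈_) Cs

  module _ (Cs : List (Subset n)) where

    BelowLayer : ℕ → Subset n → Set
    BelowLayer zero    C = Empty.⊥
    BelowLayer (suc i) C =
      ∀ D → D ∈ˡ Cs → D ≢ C → (∃[ u ] ∃[ v ] u ∈ C × v ∈ D × u ↝ v) →
      BelowLayer i D

    Layer : ℕ → Subset n → Set
    Layer i C = C ∈ˡ Cs × BelowLayer (suc i) C × ¬ BelowLayer i C

record Component (n : ℕ) : Set where
  constructor _at_
  field
    vars    : Subset n
    rankSyn : ℕ

open Component public

module _ {m n} (φ : Specification m n) where

  module _ (_↝_ : Fin n → Fin n → Set) (ps : List (Component n)) where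

    private
      Cs : List (Subset n)
      Cs = map vars ps

    EqualRanks : ℕ → Set
    EqualRanks i =
      IsSafety (_⊨ φ) ⊎
      (∀ {C D} → Layer _↝_ Cs i C → Layer _↝_ Cs i D →
       AffectsLiveness φ C → AffectsLiveness φ D → C ≡ D)

    record IsSynthesisOrder : Set where
      field
        layers   : ∀ {p q i j} → p ∈ˡ ps → q ∈ˡ ps →
                   Layer _↝_ Cs i (vars p) → Layer _↝_ Cs j (vars q) →
                   i < j → rankSyn p < rankSyn q
        equal    : ∀ {p q i} → p ∈ˡ ps → q ∈ˡ ps →
                   Layer _↝_ Cs i (vars p) → Layer _↝_ Cs i (vars q) →
                   EqualRanks i → rankSyn p ≡ rankSyn q
        distinct : ∀ {p q i} → p ∈ˡ ps → q ∈ˡ ps → p ≢ q →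
                   Layer _↝_ Cs i (vars p) → Layer _↝_ Cs i (vars q) →
                   ¬ EqualRanks i → rankSyn p ≢ rankSyn q

  record SemanticSelection (rank : ImplementationOrder n)
                           (ps : List (Component n)) : Set where
    field
      presentEdges : List (Fin n × Fin n)
      complete     : ∀ e → e ∈ˡ presentEdges ⇔ PresentEdge φ e
      removed      : List (Fin n × Fin n)
      removal      : Remove φ presentEdges [] removed
      respects     : Respects φ rank removed

    _↝_ : Fin n → Fin n → Set
    u ↝ v = FutureEdge φ (u , v) ⊎
            (PresentEdge φ (u , v) × (u , v) ∉ˡ removed)

    field
      sccs  : SCCs _↝_ (map vars ps)
      order : IsSynthesisOrder _↝_ ps

module _ {m n} (rank : ImplementationOrder n) (φ : Specification m n) where

  Synthesised : Set
  Synthesised = Σ[ p ∈ Component n ] Strategy m (vars p)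

  compose : (ss : List Synthesised) →
            Strategy m (⋃ (map (λ x → vars (proj₁ x)) ss))
  compose []             = idle
  compose ((_ , s) ∷ ss) = _∥_ rank s (compose ss)

  -- t ∥ s is dominant, where t composes those strategies of ss that belong
  -- to components of smaller rank than p.

  Suitable : List Synthesised → (p : Component n) → Strategy m (vars p) → Set
  Suitable ss p s = Dominant rank φ (_∥_ rank (compose below) s)
    where
    below : List Synthesised
    below = filter (λ x → rankSyn (proj₁ x) <? rankSyn p) ss

  IncrementalSynthesisYieldsStrategies : List (Component n) → Set
  IncrementalSynthesisYieldsStrategies ps =
    Σ[ ss ∈ List Synthesised ] map proj₁ ss ≡ ps ×
      All (λ (p , s) → Suitable ss p s) ss

  -- A component together with its strategy, once found.

  Entry : Set
  Entry = Σ[ p ∈ Component n ] Maybe (Strategy m (vars p))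

  State : Set
  State = List Entry

  components : State → List (Component n)
  components = map proj₁

  found : State → List Synthesised
  found = mapMaybe (λ (p , ms) → Maybe.map (p ,_) ms)

  LowerFound : State → Component n → Set
  LowerFound es p =
    All (λ (q , ms) → rankSyn q < rankSyn p → Is-just ms) es

  -- The component q to merge p with, the others being ps (including q).
  -- As a merged component keeps the smaller of the two ranks, the next
  -- candidates after the direct successors of p are those of its merged
  -- successor.  If p has no successor at all and yet is not the only
  -- component left, then it is merged with a peer of equal rank, or, lacking
  -- peers, with a component that it is a direct successor of.

  data Partner (p q : Component n) (ps : List (Component n)) : Set where
    successor  : rankSyn p < rankSyn q →
                 All (λ r → rankSyn p < rankSyn r → rankSyn q ≤ rankSyn r) ps →
                 Partner p q ps
    lastResort : All (λ r → rankSyn r ≤ rankSyn p) ps →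
                 All (λ r → rankSyn r ≤ rankSyn q) ps →
                 Partner p q ps

  mergeComponents : Component n → Component n → Component n
  mergeComponents p q = (vars p ∪ vars q) at (rankSyn p ⊓ rankSyn q)

  infix 4 _⟶_

  data _⟶_ (es : State) : State → Set where
    synthesise : ∀ {p} (e : (p , nothing) ∈ˡ es) → LowerFound es p →
                 ∀ s → Suitable (found es) p s →
                 es ⟶ (e ∷= (p , just s))
    merge      : ∀ {p q ms} (e : (p , nothing) ∈ˡ es) → LowerFound es p →
                 ¬ (∃[ s ] Suitable (found es) p s) →
                 (e′ : (q , ms) ∈ˡ (es ─ e)) →
                 Partner p q (components (es ─ e)) →
                 es ⟶ ((mergeComponents p q , nothing) ∷ ((es ─ e) ─ e′))

  initial : List (Component n) → State
  initial = map (_, nothing)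

  -- There is no infinite run from ps.

  ExtendedSelectionTerminates : List (Component n) → Set
  ExtendedSelectionTerminates ps = Acc (flip _⟶_) (initial ps)

  -- Some maximal run from ps ends with the components and ranks qs.

  ExtendedSelection : (ps qs : List (Component n)) → Set
  ExtendedSelection ps qs =
    Σ[ es ∈ State ] Star _⟶_ (initial ps) es ×
      ¬ (∃[ es′ ] es ⟶ es′) × components es ≡ qs

{-# OPTIONS --safe #-}

-- Termination: a step either finds a strategy or merges two components into
-- one without a strategy.  Both lower the sum in which a component counts 1
-- if it has a strategy and 2 if not.
--
-- Correctness: along a run, every strategy found stays suitable, since no
-- component of smaller rank changes any more.  A component of least rank
-- without a strategy either admits one, or can be merged, or is the only
-- component; in the last case it controls all outputs, so that the machine
-- witnessing realizability is a dominant strategy for it.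

module Submission where

open import Defs
open import Algebra.Properties.CommutativeSemigroup using (x∙yz≈y∙xz)
open import Data.Bool using (Bool; true; false; if_then_else_)
open import Data.Fin using (Fin; remQuot)
open import Data.Fin.Properties using (remQuot-combine)
open import Data.Fin.Subset using (Subset; ⊤; ⊥; ∁; _∩_; _∪_; _∈_)
open import Data.Fin.Subset.Properties using (∪-identityˡ; p⊆p∪q; q⊆p∪q)
open import Data.List using (List; []; _∷_; [_]; _++_; map; filter)
open import Data.List.Extrema.Nat
  using (argmax; argmax-sel; f[⊥]≤f[argmax]; f[xs]≤f[argmax])
open import Data.List.Membership.Propositional
  using (_∷=_; _─_) renaming (_∈_ to _∈ˡ_)
open import Data.List.Membership.Propositional.Properties using (∈-map⁺)
open import Data.List.Properties using (filter-++; filter-reject)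
open import Data.List.Relation.Unary.All as All using (All; []; _∷_)
open import Data.List.Relation.Unary.All.Properties using (map⁺; ─⁺)
open import Data.List.Relation.Unary.Any using (Any; here; there)
import Data.List.Relation.Unary.Any.Properties as Any
open import Data.Maybe using (just; nothing; Is-just)
open import Data.Maybe.Relation.Unary.Any using (just)
open import Data.Nat using (ℕ; zero; suc; _+_; _≤_; _<_; _<?_; s≤s; z≤n)
open import Data.Nat.Induction using (<-wellFounded)
open import Data.Nat.ListAction using (sum)
open import Data.Nat.Properties
  using (≤-refl; ≤-trans; ≤-total; ≮⇒≥; ≤⇒≯; <⇒≤;
         ⊓-glb; n<1+n; +-monoˡ-<; +-monoʳ-<; m<n+m; +-commutativeSemigroup;
         module ≤-Reasoning)
open import Data.Product using (∃-syntax; _×_; _,_; proj₁; proj₂)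
open import Data.Sum using (_⊎_; inj₁; inj₂)
import Data.Sum as Sum
import Data.Unit as Unit
open import Data.Vec using (lookup; tabulate)
open import Data.Vec.Properties using (lookup-replicate; tabulate-cong; []=⇒lookup)
open import Function using (flip; _∘_; case_of_)
open import Induction.WellFounded using (Acc; acc)
open import Relation.Binary.Construct.Closure.ReflexiveTransitive using (Star; ε; _◅_)
open import Relation.Binary.PropositionalEquality
  using (_≡_; _≗_; refl; sym; trans; cong; subst; module ≡-Reasoning)
open import Relation.Nullary using (¬_; yes; no; contradiction)
open import Relation.Unary using (Decidable)

module _ {A : Set} where

  ∷=⁺ : {P Q : A → Set} {xs : List A} {y : A} (e : Any P xs) →
        Q y → All Q xs → All Q (e ∷= y)
  ∷=⁺ (here _)  qy (_ ∷ qs) = qy ∷ qs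
  ∷=⁺ (there e) qy (q ∷ qs) = q ∷ ∷=⁺ e qy qs

  Any-∷= : {Q : A → Set} {x y : A} {xs : List A} (e : x ∈ˡ xs) →
           (Q x → Q y) → Any Q xs → Any Q (e ∷= y)
  Any-∷= (here refl) f (here q)   = here (f q)
  Any-∷= (here refl) f (there qs) = there qs
  Any-∷= (there e)   f (here q)   = here q
  Any-∷= (there e)   f (there qs) = there (Any-∷= e f qs)

  Any-─ : {Q : A → Set} {x : A} {xs : List A} (e : x ∈ˡ xs) →
          Any Q xs → Q x ⊎ Any Q (xs ─ e)
  Any-─ (here refl) (here q)   = inj₁ q
  Any-─ (here refl) (there qs) = inj₂ qs
  Any-─ (there e)   (here q)   = inj₂ (here q)
  Any-─ (there e)   (there qs) = Sum.map₂ there (Any-─ e qs)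

  ∈-─⁻ : {x y : A} {xs : List A} (e : x ∈ˡ xs) → y ∈ˡ (xs ─ e) → y ∈ˡ xs
  ∈-─⁻ e = All.lookup (─⁺ e (All.tabulate λ y∈xs → y∈xs))

  module _ (w : A → ℕ) where

    sum-map-∷= : {x y : A} {xs : List A} (e : x ∈ˡ xs) → w y < w x →
                 sum (map w (e ∷= y)) < sum (map w xs)
    sum-map-∷= {xs = _ ∷ xs} (here refl) wy<wx = +-monoˡ-< (sum (map w xs)) wy<wx
    sum-map-∷= {xs = x ∷ _}  (there e)   wy<wx = +-monoʳ-< (w x) (sum-map-∷= e wy<wx)

    sum-map-─ : {x : A} {xs : List A} (e : x ∈ˡ xs) →
                sum (map w xs) ≡ w x + sum (map w (xs ─ e))
    sum-map-─ (here refl) = refl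
    sum-map-─ {x} {y ∷ xs} (there e) = begin
      w y + sum (map w xs)               ≡⟨ cong (w y +_) (sum-map-─ e) ⟩
      w y + (w x + sum (map w (xs ─ e))) ≡⟨ x∙yz≈y∙xz +-commutativeSemigroup (w y) (w x) _ ⟩
      w x + (w y + sum (map w (xs ─ e))) ∎
      where open ≡-Reasoning

  least : {P : A → Set} → Decidable P → (f : A → ℕ) (xs : List A) →
          All (λ x → ¬ P x) xs ⊎
          (∃[ x ] x ∈ˡ xs × P x × All (λ y → P y → f x ≤ f y) xs)
  least P? f [] = inj₁ []
  least P? f (x ∷ xs) with P? x | least P? f xs
  ... | no ¬px | inj₁ none = inj₁ (¬px ∷ none)
  ... | no ¬px | inj₂ (y , y∈xs , py , y≤) =
    inj₂ (y , there y∈xs , py , (λ px → contradiction px ¬px) ∷ y≤)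
  ... | yes px | inj₁ none =
    inj₂ (x , here refl , px ,
          (λ _ → ≤-refl) ∷ All.map (λ ¬pz pz → contradiction pz ¬pz) none)
  ... | yes px | inj₂ (y , y∈xs , py , y≤) with ≤-total (f x) (f y)
  ...   | inj₁ x≤y =
    inj₂ (x , here refl , px ,
          (λ _ → ≤-refl) ∷ All.map (λ h pz → ≤-trans x≤y (h pz)) y≤)
  ...   | inj₂ y≤x = inj₂ (y , there y∈xs , py , (λ _ → y≤x) ∷ y≤)

module _ {m n : ℕ} where

  value-cong : {σ τ : Word m n} → σ ≗ τ → ∀ k x {b} →
               value (σ k) x ≡ b → value (τ k) x ≡ b
  value-cong σ≗τ k x = subst (λ l → value l x ≡ _) (σ≗τ k)

  ⊨ᶠ-cong : {σ τ : Word m n} → σ ≗ τ → ∀ c {k} → σ , k ⊨ᶠ c → τ , k ⊨ᶠ c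
  ⊨ᶠ-cong σ≗τ tt       h = h
  ⊨ᶠ-cong σ≗τ (pos x)  h = value-cong σ≗τ _ x h
  ⊨ᶠ-cong σ≗τ (neg x)  h = value-cong σ≗τ _ x h
  ⊨ᶠ-cong σ≗τ (a ∨ᶠ b) h = Sum.map (⊨ᶠ-cong σ≗τ a) (⊨ᶠ-cong σ≗τ b) h
  ⊨ᶠ-cong σ≗τ (X a)    h = ⊨ᶠ-cong σ≗τ a h
  ⊨ᶠ-cong σ≗τ (a U b)  (j , k≤j , hb , ha) =
    j , k≤j , ⊨ᶠ-cong σ≗τ b hb , λ l k≤l l<j → ⊨ᶠ-cong σ≗τ a (ha l k≤l l<j)
  ⊨ᶠ-cong σ≗τ (a R b)  h j k≤j =
    Sum.map (⊨ᶠ-cong σ≗τ b)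
            (λ (l , k≤l , l<j , ha) → l , k≤l , l<j , ⊨ᶠ-cong σ≗τ a ha)
            (h j k≤j)

  ⊨-cong : {σ τ : Word m n} (φ : Specification m n) → σ ≗ τ → σ ⊨ φ → τ ⊨ φ
  ⊨-cong φ σ≗τ = All.map (λ {c} → ⊨ᶠ-cong σ≗τ c)

module _ {n : ℕ} (C : Subset n) (full : ∀ u → lookup C u ≡ true) where

  private
    if-full : ∀ u {a b : Bool} → (if lookup C u then a else b) ≡ a
    if-full u rewrite full u = refl

  settle-blind : (rank : ImplementationOrder n) → ∀ {f g} e →
                 (∀ u o → f u o ≡ g u) → settle rank C f e ≡ tabulate g
  settle-blind rank _ f≡g = tabulate-cong λ u → trans (if-full u) (f≡g u _)

  settle-constant : ∀ f e →
                    settle (λ _ → 0) C f e ≡ tabulate (λ u → f u ⊥)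
  settle-constant _ _ = tabulate-cong λ u → if-full u

module _ {m n : ℕ} (φ : Specification m n) (rank : ImplementationOrder n) where

  open Strategy

  -- The current values and the environment's outputs are replaced by those
  -- that the machine sees in the definition of realizability.
  blindfold : Strategy m {n} ⊤ → (C : Subset n) → Strategy m C
  blindfold s C = record
    { size = size s
    ; init = init s
    ; out  = λ q u _ → out s q u ⊥
    ; next = λ q i _ → next s q i (⊥ ∩ ∁ ⊤)
    }

  realizable⇒dominant : Realizable φ → (C : Subset n) → (∀ u → u ∈ C) →
    ∃[ s ] Dominant rank {C = ⊥ ∪ C} φ (_∥_ rank idle s)
  realizable⇒dominant (s , realizes) C full =
    s′ , λ _ γ _ → ⊨-cong φ (same γ) (realizes (proj₁ ∘ γ))
    where
    s′ : Strategy m C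
    s′ = blindfold s C

    S : Strategy m (⊥ ∪ C)
    S = _∥_ rank idle s′

    left : Fin (size S) → Fin 1
    left q = proj₁ (remQuot {1} (size s) q)

    right : Fin (size S) → Fin (size s)
    right q = proj₂ (remQuot {1} (size s) q)

    inputs : Word m n → Word m n
    inputs γ = (proj₁ ∘ γ) ∪ʷ λ _ → ⊥

    same-state : ∀ γ k →
      right (states rank S γ k) ≡ states (λ _ → 0) s (inputs γ) k
    same-state γ zero    = cong proj₂ (remQuot-combine {1} Fin.zero (init s))
    same-state γ (suc k) =
      trans (cong proj₂ (remQuot-combine {1} (left (states rank S γ k)) _))
            (cong (λ q → next s q (proj₁ (γ k)) (⊥ ∩ ∁ ⊤)) (same-state γ k))

    same-out : ∀ q u o → out S q u o ≡ out s (right q) u ⊥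
    same-out q u o rewrite lookup-replicate {n = n} u false = refl

    same : ∀ γ → comp (λ _ → 0) s (inputs γ) ≗ comp rank S γ
    same γ k = cong (proj₁ (γ k) ,_) (trans
      (settle-constant ⊤ (λ u → lookup-replicate u true)
        (out s (states (λ _ → 0) s (inputs γ) k)) ⊥)
      (sym (settle-blind (⊥ ∪ C)
        (λ u → []=⇒lookup (subst (u ∈_) (sym (∪-identityˡ C)) (full u)))
        rank (proj₂ (γ k))
        (λ u o → trans (same-out (states rank S γ k) u o)
          (cong (λ q → out s q u ⊥) (same-state γ k))))))

  lower : ℕ → State rank φ → List (Synthesised rank φ)
  lower r es = filter (λ x → rankSyn (proj₁ x) <? r) (found rank φ es)

  lower-∷ : ∀ r x es → lower r (x ∷ es) ≡ lower r [ x ] ++ lower r es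
  lower-∷ r (p , nothing) es = refl
  lower-∷ r (p , just s)  es = filter-++ _ [ p , s ] (found rank φ es)

  lower-cong-∷ : ∀ r x es es′ → lower r es ≡ lower r es′ →
                 lower r (x ∷ es) ≡ lower r (x ∷ es′)
  lower-cong-∷ r x es es′ eq = begin
    lower r (x ∷ es)             ≡⟨ lower-∷ r x es ⟩
    lower r [ x ] ++ lower r es  ≡⟨ cong (lower r [ x ] ++_) eq ⟩
    lower r [ x ] ++ lower r es′ ≡⟨ lower-∷ r x es′ ⟨
    lower r (x ∷ es′)            ∎
    where open ≡-Reasoning

  lower-∷= : ∀ r {x} y {es} (e : x ∈ˡ es) → lower r [ x ] ≡ lower r [ y ] →
             lower r es ≡ lower r (e ∷= y)
  lower-∷= r {x} y {_ ∷ es} (here refl) eq =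
    trans (lower-∷ r x es) (trans (cong (_++ lower r es) eq) (sym (lower-∷ r y es)))
  lower-∷= r y {z ∷ es} (there e) eq =
    lower-cong-∷ r z es (e ∷= y) (lower-∷= r y e eq)

  lower-─ : ∀ r {x es} (e : x ∈ˡ es) → lower r [ x ] ≡ [] →
            lower r es ≡ lower r (es ─ e)
  lower-─ r {x} {_ ∷ es} (here refl) eq =
    trans (lower-∷ r x es) (cong (_++ lower r es) eq)
  lower-─ r {es = z ∷ es} (there e) eq =
    lower-cong-∷ r z es (es ─ e) (lower-─ r e eq)

  lower-singleton-≥ : ∀ r p ms → r ≤ rankSyn p → lower r [ p , ms ] ≡ []
  lower-singleton-≥ r p nothing  _   = refl
  lower-singleton-≥ r p (just s) r≤p =
    filter-reject (λ x → rankSyn (proj₁ x) <? r) {p , s} {[]} (≤⇒≯ r≤p)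

  weight : Entry rank φ → ℕ
  weight (_ , nothing) = 2
  weight (_ , just _)  = 1

  weight>0 : ∀ x → 0 < weight x
  weight>0 (_ , nothing) = s≤s z≤n
  weight>0 (_ , just _)  = s≤s z≤n

  totalWeight : State rank φ → ℕ
  totalWeight = sum ∘ map weight

  infix 4 _⇒_
  _⇒_ : State rank φ → State rank φ → Set
  es ⇒ es′ = _⟶_ rank φ es es′

  totalWeight-decreases : ∀ {es es′} → es ⇒ es′ → totalWeight es′ < totalWeight es
  totalWeight-decreases (synthesise e _ _ _) = sum-map-∷= weight e (n<1+n 1)
  totalWeight-decreases {es} (merge {q = q} {ms} e _ _ e′ _) = begin-strict
    2 + totalWeight ((es ─ e) ─ e′)
      <⟨ +-monoʳ-< 2 (m<n+m _ (weight>0 (q , ms))) ⟩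
    2 + (weight (q , ms) + totalWeight ((es ─ e) ─ e′))
      ≡⟨ cong (2 +_) (sum-map-─ weight e′) ⟨
    2 + totalWeight (es ─ e)
      ≡⟨ sum-map-─ weight e ⟨
    totalWeight es ∎
    where open ≤-Reasoning

  terminates : ∀ es → Acc (flip _⇒_) es
  terminates es = go es (<-wellFounded (totalWeight es))
    where
    go : ∀ es → Acc _<_ (totalWeight es) → Acc (flip _⇒_) es
    go es (acc rec) = acc λ step → go _ (rec (totalWeight-decreases step))

  Settled : State rank φ → Entry rank φ → Set
  Settled es (p , nothing) = Unit.⊤
  Settled es (p , just s)  =
    LowerFound rank φ es p × Suitable rank φ (found rank φ es) p s

  Covers : State rank φ → Set
  Covers es = ∀ v → Any (λ x → v ∈ vars (proj₁ x)) es

  record Invariant (es : State rank φ) : Set where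
    field
      settled : All (Settled es) es
      covers  : Covers es

  open Invariant

  Suitable-cong : ∀ es es′ {p} s → lower (rankSyn p) es ≡ lower (rankSyn p) es′ →
                  Suitable rank φ (found rank φ es) p s →
                  Suitable rank φ (found rank φ es′) p s
  Suitable-cong _ _ s = subst λ ss → Dominant rank φ (_∥_ rank (compose rank φ ss) s)

  ≤-unfound : ∀ r {es p} → (p , nothing) ∈ˡ es → LowerFound rank φ es r →
              rankSyn r ≤ rankSyn p
  ≤-unfound r e low = ≮⇒≥ λ p<r → case All.lookup low e p<r of λ ()

  partner-≥ : ∀ {p q r ps} → Partner rank φ p q ps → r ∈ˡ ps →
              rankSyn r ≤ rankSyn p → rankSyn r ≤ rankSyn q
  partner-≥ (successor p<q _)   r∈ps r≤p = ≤-trans r≤p (<⇒≤ p<q)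
  partner-≥ (lastResort _ all≤q) r∈ps _  = All.lookup all≤q r∈ps

  preserved : ∀ {es es′} → es ⇒ es′ → Invariant es → Invariant es′
  preserved {es} (synthesise {p} e low s suitable) inv = record
    { settled = ∷=⁺ e (retain p s (low , suitable))
        (All.map (λ {x} → stays x) (settled inv))
    ; covers  = λ v → Any-∷= {Q = λ x → v ∈ vars (proj₁ x)} e
        (λ v∈p → v∈p) (covers inv v)
    }
    where
    es′ : State rank φ
    es′ = e ∷= (p , just s)

    retain : ∀ r t → Settled es (r , just t) → Settled es′ (r , just t)
    retain r t (low′ , suitable′) =
      ∷=⁺ e (λ _ → just Unit.tt) low′ ,
      Suitable-cong es es′ t
        (lower-∷= (rankSyn r) (p , just s) e
          (sym (lower-singleton-≥ (rankSyn r) p (just s) (≤-unfound r e low′))))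
        suitable′

    stays : ∀ x → Settled es x → Settled es′ x
    stays (_ , nothing) = λ _ → Unit.tt
    stays (_ , just t)  = retain _ t
  preserved {es} (merge {p} {q} {ms} e low _ e′ partner) inv = record
    { settled = Unit.tt ∷ All.tabulate λ {x} x∈ → stays x (∈-─⁻ e′ x∈)
        (All.lookup (─⁺ e′ (─⁺ e (settled inv))) x∈)
    ; covers  = cover
    }
    where
    es′ : State rank φ
    es′ = (mergeComponents rank φ p q , nothing) ∷ ((es ─ e) ─ e′)

    stays : ∀ x → x ∈ˡ (es ─ e) → Settled es x → Settled es′ x
    stays (_ , nothing) _ _ = Unit.tt
    stays (r , just t) x∈ (low′ , suitable′) =
      (λ m<r → contradiction m<r (≤⇒≯ (⊓-glb r≤p r≤q))) ∷ ─⁺ e′ (─⁺ e low′) ,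
      Suitable-cong es es′ t
        (trans (lower-─ (rankSyn r) e refl)
               (lower-─ (rankSyn r) e′ (lower-singleton-≥ (rankSyn r) q ms r≤q)))
        suitable′
      where
      r≤p : rankSyn r ≤ rankSyn p
      r≤p = ≤-unfound r e low′

      r≤q : rankSyn r ≤ rankSyn q
      r≤q = partner-≥ partner (∈-map⁺ proj₁ x∈) r≤p

    cover : Covers es′
    cover v with Any-─ e (covers inv v)
    ... | inj₁ v∈p = here (p⊆p∪q (vars q) v∈p)
    ... | inj₂ v∈rest with Any-─ e′ v∈rest
    ...   | inj₁ v∈q    = here (q⊆p∪q (vars p) (vars q) v∈q)
    ...   | inj₂ v∈rest = there v∈rest

  preserved* : ∀ {es es′} → Star _⇒_ es es′ → Invariant es → Invariant es′
  preserved* ε          inv = inv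
  preserved* (st ◅ sts) inv = preserved* sts (preserved st inv)

  initial-invariant : ∀ {ps} → (∀ v → Any (v ∈_) (map vars ps)) →
                      Invariant (initial rank φ ps)
  initial-invariant {ps} cover = record
    { settled = map⁺ (All.tabulate λ _ → Unit.tt)
    ; covers  = λ v → Any.map⁺ (Any.map⁻ (cover v))
    }

  partner-exists : ∀ p es → es ≡ [] ⊎
    (∃[ q ] ∃[ ms ] (q , ms) ∈ˡ es × Partner rank φ p q (components rank φ es))
  partner-exists p [] = inj₁ refl
  partner-exists p es@(x ∷ xs)
    with least (λ y → rankSyn p <? rankSyn (proj₁ y)) (rankSyn ∘ proj₁) es
  ... | inj₂ ((q , ms) , q∈ , p<q , q≤) =
    inj₂ (q , ms , q∈ , successor p<q (map⁺ q≤))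
  ... | inj₁ none =
    inj₂ (proj₁ highest , proj₂ highest , highest∈ (argmax-sel (rankSyn ∘ proj₁) x xs) ,
          lastResort (map⁺ (All.map ≮⇒≥ none)) (map⁺ ≤highest))
    where
    highest : Entry rank φ
    highest = argmax (rankSyn ∘ proj₁) x xs

    highest∈ : highest ≡ x ⊎ highest ∈ˡ xs → highest ∈ˡ es
    highest∈ (inj₁ eq)   = here eq
    highest∈ (inj₂ h∈xs) = there h∈xs

    ≤highest : All (λ y → rankSyn (proj₁ y) ≤ rankSyn (proj₁ highest)) es
    ≤highest = f[⊥]≤f[argmax] {f = rankSyn ∘ proj₁} x xs ∷
               f[xs]≤f[argmax] {f = rankSyn ∘ proj₁} x xs

  Unfound : Entry rank φ → Set
  Unfound (_ , ms) = ms ≡ nothing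

  unfound? : Decidable Unfound
  unfound? (_ , nothing) = yes refl
  unfound? (_ , just _)  = no λ ()

  progress : Realizable φ → ∀ {es} → Invariant es → ∀ p → (p , nothing) ∈ˡ es →
             LowerFound rank φ es p → ¬ ¬ (∃[ es′ ] es ⇒ es′)
  progress realizable {es} inv p e low stuck with partner-exists p (es ─ e)
  ... | inj₂ (q , ms , e′ , partner) =
    stuck (_ , merge e low (λ (s , suitable) → stuck (_ , synthesise e low s suitable))
                     e′ partner)
  ... | inj₁ alone = stuck (_ , synthesise e low (proj₁ dominant) suitable)
    where
    full : ∀ v → v ∈ vars p
    full v with Any-─ e (covers inv v)
    ... | inj₁ v∈p = v∈p
    ... | inj₂ v∈rest =
      contradiction (subst (Any (λ x → v ∈ vars (proj₁ x))) alone v∈rest) λ ()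

    dominant = realizable⇒dominant realizable (vars p) full

    suitable : Suitable rank φ (found rank φ es) p (proj₁ dominant)
    suitable = Suitable-cong [] es (proj₁ dominant)
      (sym (trans (lower-─ (rankSyn p) e refl) (cong (lower (rankSyn p)) alone)))
      (proj₂ dominant)

  stuck⇒all-found : Realizable φ → ∀ {es} → Invariant es → ¬ (∃[ es′ ] es ⇒ es′) →
                    All (¬_ ∘ Unfound) es
  stuck⇒all-found realizable {es} inv stuck
    with least unfound? (rankSyn ∘ proj₁) es
  ... | inj₁ none = none
  ... | inj₂ ((p , _) , e , refl , p≤) =
    contradiction stuck (progress realizable inv p e (All.map (λ {x} → low {x}) p≤))
    where
    low : ∀ {x} → (Unfound x → rankSyn p ≤ rankSyn (proj₁ x)) →
          rankSyn (proj₁ x) < rankSyn p → Is-just (proj₂ x)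
    low {_ , nothing} p≤ q<p = contradiction q<p (≤⇒≯ (p≤ refl))
    low {_ , just _}  _  _   = just Unit.tt

  proj₁-found : ∀ {es} → All (¬_ ∘ Unfound) es →
                map proj₁ (found rank φ es) ≡ components rank φ es
  proj₁-found [] = refl
  proj₁-found {(_ , nothing) ∷ _} (¬un ∷ _) = contradiction refl ¬un
  proj₁-found {(p , just _)  ∷ _} (_ ∷ all) = cong (p ∷_) (proj₁-found all)

  found-suitable : ∀ {ss} es → All (λ x → Settled ss x) es →
    All (λ (p , s) → Suitable rank φ (found rank φ ss) p s) (found rank φ es)
  found-suitable [] [] = []
  found-suitable ((_ , nothing) ∷ es) (_ ∷ hs) = found-suitable es hs
  found-suitable ((_ , just _)  ∷ es) ((_ , suitable) ∷ hs) =
    suitable ∷ found-suitable es hs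

theorem6 : ∀ {m n : ℕ} (φ : Specification m n) → Realizable φ →
    (rank : ImplementationOrder n) (ps : List (Component n)) →
    SemanticSelection φ rank ps →
    ExtendedSelectionTerminates rank φ ps ×
    (∀ qs → ExtendedSelection rank φ ps qs →
      IncrementalSynthesisYieldsStrategies rank φ qs)
theorem6 φ realizable rank ps selection =
  terminates φ rank (initial rank φ ps) , yields
  where
  yields : ∀ qs → ExtendedSelection rank φ ps qs →
           IncrementalSynthesisYieldsStrategies rank φ qs
  yields qs (es , run , stuck , refl) =
    found rank φ es ,
    proj₁-found φ rank (stuck⇒all-found φ rank realizable inv stuck) ,
    found-suitable φ rank es (Invariant.settled inv)
    where
    inv : Invariant φ rank es
    inv = preserved* φ rank run
      (initial-invariant φ rank (SCCs.cover (SemanticSelection.sccs selection)))
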